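{- For every $n\ge1$ and $2\le i\le n+1$, \[g_{n,i}=\binom{2n-i+1}{n}\frac{i-1}{2n-i+1}.\]
   Context: $S_n(321)$ is the set of permutations $\pi=\pi_1\cdots\pi_n$ of $\{1,\dots,n\}$ avoiding $321$ (no $a<b<c$ with $\pi_a>\pi_b>\pi_c$). An entry $\pi_i$ is a left-to-right (LTR) maximum if $\pi_i>\pi_j$ for all $j<i$. For $n\ge1$ and $2\le i\le n$, $g_{n,i}$ is the number of $\pi\in S_n(321)$ such that $\pi_i$ is not an LTR maximum and $\pi_j$ is an LTR maximum for every $j<i$; also $g_{n,n+1}=1$ (counting only the identity permutation $12\cdots n$). -}

module Defs where

open import Data.Nat using (ℕ; zero; suc; _+_; _≟_)
import Data.Nat as ℕ
open import Data.Fin using (Fin; toℕ; _<_; _<?_)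
open import Data.Fin.Properties using (all?; any?) renaming (_≟_ to _≟ᶠ_)
open import Data.Vec using (Vec; []; _∷_; lookup)
open import Data.List using (List; [_]; concatMap; map; filter; length; allFin)
open import Data.Product using (_×_; ∃)
open import Relation.Nullary using (¬_; Dec; yes; no)
open import Relation.Nullary.Decidable using (_×-dec_; _→-dec_; ¬?)
open import Relation.Binary.PropositionalEquality using (_≡_)

-- A word π = π₁⋯πₙ with letters in {1,…,n} (encoded 0-based as Fin n,
-- positions also 0-based: position k : Fin n is the paper's position toℕ k + 1).
Word : ℕ → Set
Word n = Vec (Fin n) n

-- π is a permutation of {1,…,n}: injective (hence bijective, finite).
IsPerm : ∀ {n} → Word n → Set
IsPerm {n} w = (a b : Fin n) → lookup w a ≡ lookup w b → a ≡ b

Avoids321 : ∀ {n} → Word n → Set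
Avoids321 {n} w = (a b c : Fin n) → a < b → b < c →
  ¬ ((lookup w b < lookup w a) × (lookup w c < lookup w b))

IsLTRMax : ∀ {n} → Word n → Fin n → Set
IsLTRMax {n} w k = (j : Fin n) → j < k → lookup w j < lookup w k

FirstNonLTR : ∀ {n} → ℕ → Word n → Set
FirstNonLTR {n} i w =
  ((k : Fin n) → suc (toℕ k) ℕ.< i → IsLTRMax w k) ×
  ∃ λ (k : Fin n) → (suc (toℕ k) ≡ i) × ¬ IsLTRMax w k

isPerm? : ∀ {n} (w : Word n) → Dec (IsPerm w)
isPerm? w = all? λ a → all? λ b → (lookup w a ≟ᶠ lookup w b) →-dec (a ≟ᶠ b)

avoids321? : ∀ {n} (w : Word n) → Dec (Avoids321 w)
avoids321? w = all? λ a → all? λ b → all? λ c →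
  (a <? b) →-dec (b <? c) →-dec
  ¬? ((lookup w b <? lookup w a) ×-dec (lookup w c <? lookup w b))

isLTRMax? : ∀ {n} (w : Word n) (k : Fin n) → Dec (IsLTRMax w k)
isLTRMax? w k = all? λ j → (j <? k) →-dec (lookup w j <? lookup w k)

firstNonLTR? : ∀ {n} (i : ℕ) (w : Word n) → Dec (FirstNonLTR i w)
firstNonLTR? i w =
  (all? λ k → (suc (toℕ k) ℕ.<? i) →-dec isLTRMax? w k) ×-dec
  any? (λ k → (suc (toℕ k) ≟ i) ×-dec ¬? (isLTRMax? w k))

allWords : ∀ {n} (m : ℕ) → List (Vec (Fin n) m)
allWords zero = [ [] ]
allWords {n} (suc m) =
  concatMap (λ x → map (x ∷_) (allWords m)) (allFin n)

Good : ∀ {n} → ℕ → Word n → Set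
Good i w = IsPerm w × Avoids321 w × FirstNonLTR i w

good? : ∀ {n} (i : ℕ) (w : Word n) → Dec (Good i w)
good? i w = isPerm? w ×-dec avoids321? w ×-dec firstNonLTR? i w

g : ℕ → ℕ → ℕ
g n i with i ≟ suc n
... | yes _ = 1
... | no _  = length (filter (good? i) (allWords {n} n))

-- Read from left to right, a permutation avoids 321 exactly when each entry is
-- either a new left-to-right maximum or the smallest value not used so far.
-- So the number of admissible completions of a prefix depends only on the
-- number a of unused values below its maximum and the number b of values above
-- it, and the first-step recursion in (a, b) is solved by the ballot numbers
-- C(a+2b, b) − C(a+2b, b−1). The words counted by g_{n,i} start with i − 1
-- maxima followed by a non-maximum; the same Pascal-triangle induction shows
-- that there are C(2n−i, n−i+1) − C(2n−i, n−i) of them, which rearranges to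
-- the stated product formula.

module Submission where

open import Defs
open import Data.Fin as Fin using (Fin; toℕ)
import Data.Fin.Properties as FinP
open import Data.List using (List; []; _∷_; _++_; [_]; map; concatMap; length; filter; tabulate; allFin)
open import Data.List.Properties
  using (map-++; map-∘; map-cong; map-tabulate; length-++; ++-assoc; ++-identityʳ)
open import Data.List.Membership.Propositional using (_∈_; _∉_)
open import Data.List.Membership.Propositional.Properties using (∈-++⁺ˡ; ∈-++⁺ʳ; ∈-++⁻)
open import Data.List.Relation.Unary.All as All using (All; []; _∷_)
open import Data.List.Relation.Unary.Any using (here; there)
open import Data.Nat using (ℕ; zero; suc; _+_; _*_; _∸_; _≤_; _<_; _⊔_; z≤n; s≤s; s≤s⁻¹)
open import Data.Nat.Properties
open import Algebra.Properties.CommutativeMonoid.Sum +-0-commutativeMonoid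
  using (sum-syntax; sum-cong-≗; sum-replicate-zero; ∑-distrib-+)
open import Data.Nat.Combinatorics
  using (_C_; nCk+nC[k+1]≡[n+1]C[k+1]; nCk≡nC[n∸k]; nCn≡1; nC1≡n; k>n⇒nCk≡0)
open import Data.Nat.ListAction using () renaming (sum to sumˡ)
open import Data.Nat.ListAction.Properties using (sum-++)
open import Data.Nat.Tactic.RingSolver using (solve-∀)
open import Data.Product using (_×_; _,_; proj₂; ∃)
open import Data.Sum using (_⊎_; inj₁; inj₂; [_,_]′)
open import Data.Unit using (⊤; tt)
open import Data.Vec using (Vec; []; _∷_; toList; lookup)
open import Function using (_∘_; id)
open import Relation.Binary using (tri<; tri≈; tri>)
open import Relation.Binary.PropositionalEquality hiding ([_])
open import Relation.Nullary using (Dec; yes; no; ¬_; contradiction)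
open import Relation.Nullary.Decidable using (_×-dec_; _⊎-dec_; _→-dec_; ¬?)
open import Relation.Unary using (Pred; Decidable)

_C⁻_ : ℕ → ℕ → ℕ
N C⁻ zero  = 0
N C⁻ suc d = N C d

suc-C : ∀ N d → suc N C d ≡ N C⁻ d + N C d
suc-C N zero    = refl
suc-C N (suc d) = sym (nCk+nC[k+1]≡[n+1]C[k+1] N d)

C-central : ∀ d {K} → K ≡ suc (d * 2) → K C d ≡ K C suc d
C-central d refl = begin
  suc (d * 2) C d             ≡⟨ cong (suc (d * 2) C_) d*2∸d≡d ⟨
  suc (d * 2) C (d * 2 ∸ d)   ≡⟨ nCk≡nC[n∸k] (s≤s d≤d*2) ⟨
  suc (d * 2) C suc d         ∎
  where
  open ≡-Reasoning
  d*2≡d+d : d * 2 ≡ d + d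
  d*2≡d+d = trans (*-comm d 2) (cong (d +_) (+-identityʳ d))
  d*2∸d≡d : d * 2 ∸ d ≡ d
  d*2∸d≡d = trans (cong (_∸ d) d*2≡d+d) (m+n∸n≡m d d)
  d≤d*2 : d ≤ d * 2
  d≤d*2 = ≤-trans (m≤m+n d d) (≤-reflexive (sym d*2≡d+d))

suc-*-C-suc : ∀ m k → suc k * (suc m C suc k) ≡ suc m * (m C k)
suc-*-C-suc m zero = begin
  suc m C 1 + 0 ≡⟨ +-identityʳ _ ⟩
  suc m C 1     ≡⟨ nC1≡n (suc m) ⟩
  suc m         ≡⟨ *-identityʳ (suc m) ⟨
  suc m * 1     ∎
  where open ≡-Reasoning
suc-*-C-suc zero (suc k) rewrite k>n⇒nCk≡0 {1} {suc (suc k)} (s≤s (s≤s z≤n))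
                               | k>n⇒nCk≡0 {0} {suc k} (s≤s z≤n)
                               | *-zeroʳ (suc (suc k)) = refl
suc-*-C-suc (suc m) (suc k) = begin
  suc (suc k) * (suc (suc m) C suc (suc k))  ≡⟨ cong (suc (suc k) *_) (nCk+nC[k+1]≡[n+1]C[k+1] (suc m) (suc k)) ⟨
  suc (suc k) * (A + B)                      ≡⟨ *-distribˡ-+ (suc (suc k)) A B ⟩
  (A + suc k * A) + suc (suc k) * B          ≡⟨ cong₂ (λ u v → (A + u) + v) (suc-*-C-suc m k) (suc-*-C-suc m (suc k)) ⟩
  (A + suc m * (m C k)) + suc m * (m C suc k) ≡⟨ +-assoc A _ _ ⟩
  A + (suc m * (m C k) + suc m * (m C suc k)) ≡⟨ cong (A +_) (*-distribˡ-+ (suc m) (m C k) (m C suc k)) ⟨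
  A + suc m * (m C k + m C suc k)            ≡⟨ cong (λ u → A + suc m * u) (nCk+nC[k+1]≡[n+1]C[k+1] m k) ⟩
  A + suc m * A                              ∎
  where
  open ≡-Reasoning
  A = suc m C suc k
  B = suc m C suc (suc k)

+-C-difference : ∀ {G₁ G₂} K d → G₁ + K C d ≡ K C suc d → G₂ + K C⁻ d ≡ K C d →
                 (G₁ + G₂) + suc K C⁻ suc d ≡ suc K C suc d
+-C-difference {G₁} {G₂} K d e₁ e₂ = begin
  (G₁ + G₂) + suc K C d               ≡⟨ cong (G₁ + G₂ +_) (suc-C K d) ⟩
  (G₁ + G₂) + (K C⁻ d + K C d)        ≡⟨ rearrange G₁ G₂ (K C⁻ d) (K C d) ⟩
  (G₂ + K C⁻ d) + (G₁ + K C d)        ≡⟨ cong₂ _+_ e₂ e₁ ⟩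
  K C d + K C suc d                   ≡⟨ nCk+nC[k+1]≡[n+1]C[k+1] K d ⟩
  suc K C suc d                       ∎
  where
  open ≡-Reasoning
  rearrange : ∀ a b c d → (a + b) + (c + d) ≡ (b + c) + (a + d)
  rearrange = solve-∀

when : ∀ {p} {P : Set p} → Dec P → ℕ → ℕ
when (yes _) c = c
when (no _)  _ = 0

𝟙 : ∀ {p} {P : Set p} → Dec P → ℕ
𝟙 P? = when P? 1

unless : ∀ {p} {P : Set p} → Dec P → ℕ → ℕ
unless (yes _) _ = 0
unless (no _)  c = c

when-yes : ∀ {p} {P : Set p} (P? : Dec P) c → P → when P? c ≡ c
when-yes (yes _) c _ = refl
when-yes (no ¬p) c p = contradiction p ¬p

when-no : ∀ {p} {P : Set p} (P? : Dec P) c → ¬ P → when P? c ≡ 0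
when-no (yes p) c ¬p = contradiction p ¬p
when-no (no _)  c _  = refl

unless-yes : ∀ {p} {P : Set p} (P? : Dec P) c → P → unless P? c ≡ 0
unless-yes (yes _) c _ = refl
unless-yes (no ¬p) c p = contradiction p ¬p

unless-no : ∀ {p} {P : Set p} (P? : Dec P) c → ¬ P → unless P? c ≡ c
unless-no (yes p) c ¬p = contradiction p ¬p
unless-no (no _)  c _  = refl

when-⇔ : ∀ {p q} {P : Set p} {Q : Set q} (P? : Dec P) (Q? : Dec Q) c →
         (P → Q) → (Q → P) → when P? c ≡ when Q? c
when-⇔ (yes _) (yes _) c _   _   = refl
when-⇔ (no _)  (no _)  c _   _   = refl
when-⇔ (yes p) (no ¬q) c p→q _   = contradiction (p→q p) ¬q
when-⇔ (no ¬p) (yes q) c _   q→p = contradiction (q→p q) ¬p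

when-⊎ : ∀ {p q r} {P : Set p} {Q : Set q} {R : Set r} (P? : Dec P) (Q? : Dec Q) (R? : Dec R) c →
         (P → Q ⊎ R) → (Q ⊎ R → P) → (Q → ¬ R) → when P? c ≡ when Q? c + when R? c
when-⊎ P? (yes q) (yes r) c _ _ q→¬r = contradiction r (q→¬r q)
when-⊎ P? (yes q) (no ¬r) c _ fromQR _ = trans (when-yes P? c (fromQR (inj₁ q))) (sym (+-identityʳ c))
when-⊎ P? (no ¬q) (yes r) c _ fromQR _ = when-yes P? c (fromQR (inj₂ r))
when-⊎ P? (no ¬q) (no ¬r) c toQR _ _ = when-no P? c λ p → [ ¬q , ¬r ]′ (toQR p)

when-× : ∀ {p q} {P : Set p} {Q : Set q} (P? : Dec P) (Q? : Dec Q) c →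
         when (P? ×-dec Q?) c ≡ when P? (when Q? c)
when-× (yes _) (yes _) c = refl
when-× (yes _) (no _)  c = refl
when-× (no _)  _       c = refl

∑-zero : ∀ n {f : Fin n → ℕ} → (∀ x → f x ≡ 0) → ∑[ x < n ] f x ≡ 0
∑-zero n f≡0 = trans (sum-cong-≗ {n} f≡0) (sum-replicate-zero n)

∑-when-≟ : ∀ n (x₀ : Fin n) c → ∑[ x < n ] when (x FinP.≟ x₀) c ≡ c
∑-when-≟ (suc n) Fin.zero c =
  trans (cong (c +_) (∑-zero n (λ x → when-no (Fin.suc x FinP.≟ Fin.zero) c λ ()))) (+-identityʳ c)
∑-when-≟ (suc n) (Fin.suc x₀) c =
  trans (sum-cong-≗ {n} (λ x → when-⇔ (Fin.suc x FinP.≟ Fin.suc x₀) (x FinP.≟ x₀) c FinP.suc-injective (cong Fin.suc)))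
        (∑-when-≟ n x₀ c)

∑-when-≤ : ∀ M n (h : ℕ → ℕ) → ∑[ v < n ] when (M ≤? toℕ v) (h (toℕ v)) ≡ ∑[ t < n ∸ M ] h (M + toℕ t)
∑-when-≤ zero    n       h = sum-cong-≗ {n} λ _ → refl
∑-when-≤ (suc M) zero    h = refl
∑-when-≤ (suc M) (suc n) h =
  trans (sum-cong-≗ {n} λ v → when-⇔ (suc M ≤? suc (toℕ v)) (M ≤? toℕ v) _ s≤s⁻¹ s≤s)
        (∑-when-≤ M n (h ∘ suc))

∑-𝟙-< : ∀ c M X → X ∸ M ≤ c → ∑[ t < c ] 𝟙 (M + toℕ t <? X) ≡ X ∸ M
∑-𝟙-< zero    M X X∸M≤0 = sym (n≤0⇒n≡0 X∸M≤0)
∑-𝟙-< (suc c) M X X∸M≤c = begin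
  𝟙 (M + 0 <? X) + ∑[ t < c ] 𝟙 (M + suc (toℕ t) <? X)
    ≡⟨ cong₂ _+_ (cong (λ m → 𝟙 (m <? X)) (+-identityʳ M))
                 (sum-cong-≗ {c} λ t → cong (λ m → 𝟙 (m <? X)) (+-suc M (toℕ t))) ⟩
  𝟙 (M <? X) + ∑[ t < c ] 𝟙 (suc M + toℕ t <? X)
    ≡⟨ cong (𝟙 (M <? X) +_) (∑-𝟙-< c (suc M) X X∸[1+M]≤c) ⟩
  𝟙 (M <? X) + (X ∸ suc M)
    ≡⟨ first ⟩
  X ∸ M ∎
  where
  open ≡-Reasoning
  X∸[1+M]≤c : X ∸ suc M ≤ c
  X∸[1+M]≤c = ≤-trans (≤-reflexive (sym (pred[m∸n]≡m∸[1+n] X M))) (pred-mono-≤ X∸M≤c)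
  first : 𝟙 (M <? X) + (X ∸ suc M) ≡ X ∸ M
  first with M <? X
  ... | yes M<X = sym (+-∸-assoc 1 M<X)
  ... | no  M≮X = trans (m≤n⇒m∸n≡0 (≤-trans (≮⇒≥ M≮X) (n≤1+n M))) (sym (m≤n⇒m∸n≡0 (≮⇒≥ M≮X)))

∑-𝟙-interval : ∀ n M X → X ≤ n → ∑[ z < n ] 𝟙 ((M ≤? toℕ z) ×-dec (toℕ z <? X)) ≡ X ∸ M
∑-𝟙-interval n M X X≤n = begin
  ∑[ z < n ] 𝟙 ((M ≤? toℕ z) ×-dec (toℕ z <? X))   ≡⟨ sum-cong-≗ {n} (λ z → when-× (M ≤? toℕ z) (toℕ z <? X) 1) ⟩
  ∑[ z < n ] when (M ≤? toℕ z) (𝟙 (toℕ z <? X))     ≡⟨ ∑-when-≤ M n (λ v → 𝟙 (v <? X)) ⟩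
  ∑[ t < n ∸ M ] 𝟙 (M + toℕ t <? X)                ≡⟨ ∑-𝟙-< (n ∸ M) M X (∸-monoˡ-≤ M X≤n) ⟩
  X ∸ M                                            ∎
  where open ≡-Reasoning

length-filter≡sum-𝟙 : ∀ {a p} {A : Set a} {P : Pred A p} (P? : Decidable P) xs →
                      length (filter P? xs) ≡ sumˡ (map (𝟙 ∘ P?) xs)
length-filter≡sum-𝟙 P? []       = refl
length-filter≡sum-𝟙 P? (x ∷ xs) with P? x
... | yes _ = cong suc (length-filter≡sum-𝟙 P? xs)
... | no _  = length-filter≡sum-𝟙 P? xs

sum-map-when : ∀ {a p} {A : Set a} {P : Set p} (P? : Dec P) (f : A → ℕ) xs →
               sumˡ (map (λ x → when P? (f x)) xs) ≡ when P? (sumˡ (map f xs))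
sum-map-when (yes _) f xs       = refl
sum-map-when (no _)  f []       = refl
sum-map-when (no ¬p) f (x ∷ xs) = sum-map-when (no ¬p) f xs

sum-map-concatMap : ∀ {a b} {A : Set a} {B : Set b} (f : B → ℕ) (g : A → List B) xs →
                    sumˡ (map f (concatMap g xs)) ≡ sumˡ (map (λ x → sumˡ (map f (g x))) xs)
sum-map-concatMap f g []       = refl
sum-map-concatMap f g (x ∷ xs) = begin
  sumˡ (map f (g x ++ concatMap g xs))              ≡⟨ cong sumˡ (map-++ f (g x) _) ⟩
  sumˡ (map f (g x) ++ map f (concatMap g xs))      ≡⟨ sum-++ (map f (g x)) _ ⟩
  sumˡ (map f (g x)) + sumˡ (map f (concatMap g xs)) ≡⟨ cong (sumˡ (map f (g x)) +_) (sum-map-concatMap f g xs) ⟩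
  sumˡ (map f (g x)) + sumˡ (map (λ x → sumˡ (map f (g x))) xs) ∎
  where open ≡-Reasoning

sum-map-allFin : ∀ n (f : Fin n → ℕ) → sumˡ (map f (allFin n)) ≡ ∑[ x < n ] f x
sum-map-allFin n f = trans (cong sumˡ (map-tabulate id f)) (sum-tabulate n f)
  where
  sum-tabulate : ∀ n (f : Fin n → ℕ) → sumˡ (tabulate f) ≡ ∑[ x < n ] f x
  sum-tabulate zero    f = refl
  sum-tabulate (suc n) f = cong (f Fin.zero +_) (sum-tabulate n (f ∘ Fin.suc))

∑words : ∀ {n} m → (Vec (Fin n) m → ℕ) → ℕ
∑words m f = sumˡ (map f (allWords m))

∑words-suc : ∀ {n} m (f : Vec (Fin n) (suc m) → ℕ) → ∑words (suc m) f ≡ ∑[ x < n ] ∑words m (f ∘ (x ∷_))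
∑words-suc {n} m f = begin
  sumˡ (map f (concatMap (λ x → map (x ∷_) (allWords m)) (allFin n)))
    ≡⟨ sum-map-concatMap f _ (allFin n) ⟩
  sumˡ (map (λ x → sumˡ (map f (map (x ∷_) (allWords m)))) (allFin n))
    ≡⟨ cong sumˡ (map-cong (λ x → cong sumˡ (sym (map-∘ (allWords m)))) (allFin n)) ⟩
  sumˡ (map (λ x → ∑words m (f ∘ (x ∷_))) (allFin n))
    ≡⟨ sum-map-allFin n _ ⟩
  ∑[ x < n ] ∑words m (f ∘ (x ∷_)) ∎
  where open ≡-Reasoning

-- Ballot numbers

-- The next letter after a prefix with a unused values below its maximum and b
-- above it is either a new maximum t places above the old one, leaving a + t and
-- b − t − 1, or the least unused value, which must then lie below the maximum.
maxSteps : (ℕ → ℕ → ℕ) → ℕ → ℕ → ℕ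
maxSteps f a b = ∑[ t < b ] f (a + toℕ t) (b ∸ suc (toℕ t))

minStep : (ℕ → ℕ → ℕ) → ℕ → ℕ → ℕ
minStep f zero    b = 0
minStep f (suc a) b = f a b

maxSteps-suc : ∀ f a b → maxSteps f a (suc b) ≡ f a b + maxSteps f (suc a) b
maxSteps-suc f a b = cong₂ _+_ (cong (λ x → f x b) (+-identityʳ a))
  (sum-cong-≗ {b} (λ t → cong (λ x → f x (b ∸ suc (toℕ t))) (+-suc a (toℕ t))))

maxSteps-cong : ∀ {f g} a b → (∀ x y → suc (x + y) ≡ a + b → f x y ≡ g x y) →
                maxSteps f a b ≡ maxSteps g a b
maxSteps-cong a b f≡g = sum-cong-≗ {b} λ t → f≡g _ _ (step-total (toℕ t) (FinP.toℕ<n t))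
  where
  step-total : ∀ t → t < b → suc (a + t + (b ∸ suc t)) ≡ a + b
  step-total t t<b = begin
    suc (a + t + (b ∸ suc t))   ≡⟨ cong suc (+-assoc a t _) ⟩
    suc (a + (t + (b ∸ suc t))) ≡⟨ +-suc a _ ⟨
    a + (suc t + (b ∸ suc t))   ≡⟨ cong (a +_) (m+[n∸m]≡n t<b) ⟩
    a + b                       ∎
    where open ≡-Reasoning

minStep-cong : ∀ {f g} a b → (∀ x y → suc (x + y) ≡ a + b → f x y ≡ g x y) →
               minStep f a b ≡ minStep g a b
minStep-cong zero    b f≡g = refl
minStep-cong (suc a) b f≡g = f≡g a b refl

ballot : ℕ → ℕ → ℕ
ballot a       zero    = 1
ballot zero    (suc b) = ballot 1 b
ballot (suc a) (suc b) = ballot a (suc b) + ballot (suc (suc a)) b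

ballot-closed : ∀ a d {N} → a + d * 2 ≡ N → ballot a d + N C⁻ d ≡ N C d
ballot-closed a       zero    refl = refl
ballot-closed zero    (suc d) refl =
  +-C-difference (suc (d * 2)) d (C-central d refl) (ballot-closed 1 d refl)
ballot-closed (suc a) (suc d) refl =
  +-C-difference (a + suc (suc (d * 2))) d
    (ballot-closed a (suc d) refl)
    (ballot-closed (suc (suc a)) d (sym (trans (+-suc a (suc (d * 2))) (cong suc (+-suc a (d * 2))))))

ballot-by-first-step : ∀ a b → 1 ≤ a + b → maxSteps ballot a b + minStep ballot a b ≡ ballot a b
ballot-by-first-step (suc a) zero    _ = refl
ballot-by-first-step a       (suc b) _ = begin
  maxSteps ballot a (suc b) + minStep ballot a (suc b)         ≡⟨ cong (_+ minStep ballot a (suc b)) (maxSteps-suc ballot a b) ⟩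
  (ballot a b + maxSteps ballot (suc a) b) + minStep ballot a (suc b)
    ≡⟨ cong (_+ minStep ballot a (suc b)) (+-comm (ballot a b) _) ⟩
  (maxSteps ballot (suc a) b + ballot a b) + minStep ballot a (suc b)
    ≡⟨ cong (_+ minStep ballot a (suc b)) (ballot-by-first-step (suc a) b (s≤s z≤n)) ⟩
  ballot (suc a) b + minStep ballot a (suc b)                  ≡⟨ last-step a ⟩
  ballot a (suc b)                                             ∎
  where
  open ≡-Reasoning
  last-step : ∀ a → ballot (suc a) b + minStep ballot a (suc b) ≡ ballot a (suc b)
  last-step zero    = +-identityʳ (ballot 1 b)
  last-step (suc a) = +-comm (ballot (suc (suc a)) b) (ballot a (suc b))

-- Completions whose next r letters are new maxima and whose following letter is not.
ballotAt : ℕ → ℕ → ℕ → ℕ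
ballotAt zero    a       b       = minStep ballot a b
ballotAt (suc r) a       zero    = 0
ballotAt (suc r) a       (suc b) = ballotAt r a b + ballotAt (suc r) (suc a) b

ballotAt-vanishes : ∀ r a b → b ≤ r → ballotAt (suc r) a b ≡ 0
ballotAt-vanishes r       a zero    _         = refl
ballotAt-vanishes (suc r) a (suc b) (s≤s b≤r) =
  cong₂ _+_ (ballotAt-vanishes r a b b≤r) (ballotAt-vanishes (suc r) (suc a) b (m≤n⇒m≤1+n b≤r))

ballotAt-diagonal : ∀ r a → ballotAt r (suc a) r ≡ 1
ballotAt-diagonal zero    a = refl
ballotAt-diagonal (suc r) a =
  cong₂ _+_ (ballotAt-diagonal r a) (ballotAt-vanishes r (suc (suc a)) r ≤-refl)

ballotAt-by-first-step : ∀ r a b → maxSteps (ballotAt r) a b ≡ ballotAt (suc r) a b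
ballotAt-by-first-step r a zero    = refl
ballotAt-by-first-step r a (suc b) =
  trans (maxSteps-suc (ballotAt r) a b) (cong (ballotAt r a b +_) (ballotAt-by-first-step r (suc a) b))

ballotAt-closed : ∀ r a d {N} → d * 2 + (r + a) ≡ suc N → 1 ≤ a + d →
                  ballotAt r a (r + d) + N C⁻ d ≡ N C d
ballotAt-closed zero    zero    zero    ()   _
ballotAt-closed zero    zero    (suc d) refl _ = C-central d (cong suc (+-identityʳ (d * 2)))
ballotAt-closed zero    (suc a) d       eq   _ =
  ballot-closed a d (suc-injective (trans (cong suc (+-comm a (d * 2))) (trans (sym (+-suc (d * 2) a)) eq)))
ballotAt-closed (suc r) zero    zero    _    ()
ballotAt-closed (suc r) (suc a) zero    _    _ =
  trans (+-identityʳ _) (subst (λ b → ballotAt (suc r) (suc a) b ≡ 1) (sym (+-identityʳ (suc r))) (ballotAt-diagonal (suc r) a))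
ballotAt-closed (suc r) a       (suc d) refl _ =
  +-C-difference K d
    (ballotAt-closed r a (suc d) (cong suc (sym (+-suc (d * 2) (r + a))))
       (≤-trans (s≤s z≤n) (m≤n+m (suc d) a)))
    (subst (λ b → ballotAt (suc r) (suc a) b + K C⁻ d ≡ K C d) (sym (+-suc r d))
      (ballotAt-closed (suc r) (suc a) d (index-shift r a d) (s≤s z≤n)))
  where
  K = d * 2 + suc (r + a)
  index-shift : ∀ r a d → d * 2 + (suc r + suc a) ≡ suc (d * 2 + suc (r + a))
  index-shift = solve-∀

-- With S = 2E + r, the relations below say G = W − Y and E·X = S·Y, X = Y + W;
-- hence S·G = S·X − 2·E·X = r·X.
difference-product : ∀ {G X Y W} E r → G + Y ≡ W → X ≡ Y + W → E * X ≡ (E * 2 + r) * Y →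
                     G * (E * 2 + r) ≡ X * r
difference-product {G} {X} {Y} {W} E r G+Y≡W X≡Y+W EX≡SY =
  +-cancelʳ-≡ (E * X + E * X) _ _ (trans (sym S*X≡S*G+2EX) (expand E r X))
  where
  open ≡-Reasoning
  S = E * 2 + r
  expand : ∀ E r X → (E * 2 + r) * X ≡ X * r + (E * X + E * X)
  expand = solve-∀
  collect : ∀ a g s → a + (s * g + a) ≡ g * s + (a + a)
  collect = solve-∀
  S*X≡S*G+2EX : S * X ≡ G * S + (E * X + E * X)
  S*X≡S*G+2EX = begin
    S * X                       ≡⟨ cong (S *_) X≡Y+W ⟩
    S * (Y + W)                 ≡⟨ *-distribˡ-+ S Y W ⟩
    S * Y + S * W               ≡⟨ cong₂ _+_ (sym EX≡SY) (cong (S *_) (sym G+Y≡W)) ⟩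
    E * X + S * (G + Y)         ≡⟨ cong (E * X +_) (*-distribˡ-+ S G Y) ⟩
    E * X + (S * G + S * Y)     ≡⟨ cong (λ u → E * X + (S * G + u)) (sym EX≡SY) ⟩
    E * X + (S * G + E * X)     ≡⟨ collect (E * X) G S ⟩
    G * S + (E * X + E * X)     ∎

ballotAt-product : ∀ r e → ballotAt r 0 (r + suc e) * (suc e * 2 + r) ≡ ((suc e * 2 + r) C (r + suc e)) * r
ballotAt-product r e =
  subst (λ X → ballotAt r 0 (r + suc e) * suc K ≡ X * r) (sym symmetric)
    (difference-product (suc e) r gap (sym (nCk+nC[k+1]≡[n+1]C[k+1] K e)) (suc-*-C-suc K e))
  where
  K = suc (e * 2 + r)
  gap : ballotAt r 0 (r + suc e) + K C e ≡ K C suc e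
  gap = ballotAt-closed r 0 (suc e) (cong (λ m → suc (suc (e * 2 + m))) (+-identityʳ r)) (s≤s z≤n)
  suc-K≡r+suc-e+suc-e : ∀ r e → suc (suc (e * 2 + r)) ≡ r + suc e + suc e
  suc-K≡r+suc-e+suc-e = solve-∀
  symmetric : suc K C (r + suc e) ≡ suc K C suc e
  symmetric = begin
    suc K C (r + suc e)
      ≡⟨ nCk≡nC[n∸k] (≤-trans (m≤m+n (r + suc e) (suc e)) (≤-reflexive (sym (suc-K≡r+suc-e+suc-e r e)))) ⟩
    suc K C (suc K ∸ (r + suc e))       ≡⟨ cong (λ m → suc K C (m ∸ (r + suc e))) (suc-K≡r+suc-e+suc-e r e) ⟩
    suc K C (r + suc e + suc e ∸ (r + suc e)) ≡⟨ cong (suc K C_) (m+n∸m≡n (r + suc e) (suc e)) ⟩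
    suc K C suc e                       ∎
    where open ≡-Reasoning

-- Counting admissible completions

-- ways m k a b counts the admissible ways to append m letters to a prefix of
-- length k whose entries leave a gaps below their maximum and b values above it.
module Transfer (i : ℕ) where

  ways : ℕ → ℕ → ℕ → ℕ → ℕ
  ways zero    k a b = 1
  ways (suc m) k a b = unless (suc k ≟ i) (maxSteps (ways m (suc k)) a b)
                     + unless (suc k <? i) (minStep (ways m (suc k)) a b)

  ways-free : ∀ m k a b → i ≤ k → m ≡ a + b → ways m k a b ≡ ballot a b
  ways-free zero    k zero    zero    _   _  = refl
  ways-free (suc m) k a       b       i≤k eq = begin
    unless (suc k ≟ i) (maxSteps (ways m (suc k)) a b) + unless (suc k <? i) (minStep (ways m (suc k)) a b)
      ≡⟨ cong₂ _+_ (unless-no (suc k ≟ i) _ (λ e → <⇒≢ (s≤s i≤k) (sym e)))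
                   (unless-no (suc k <? i) _ (λ lt → <⇒≱ lt (m≤n⇒m≤1+n i≤k))) ⟩
    maxSteps (ways m (suc k)) a b + minStep (ways m (suc k)) a b
      ≡⟨ cong₂ _+_ (maxSteps-cong a b free) (minStep-cong a b free) ⟩
    maxSteps ballot a b + minStep ballot a b
      ≡⟨ ballot-by-first-step a b (≤-trans (s≤s z≤n) (≤-reflexive eq)) ⟩
    ballot a b ∎
    where
    open ≡-Reasoning
    free : ∀ x y → suc (x + y) ≡ a + b → ways m (suc k) x y ≡ ballot x y
    free x y step = ways-free m (suc k) x y (m≤n⇒m≤1+n i≤k) (suc-injective (trans eq (sym step)))

  ways-forced : ∀ m k a b → suc k ≤ i → i ≤ k + m → m ≡ a + b → ways m k a b ≡ ballotAt (i ∸ suc k) a b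
  ways-forced zero    k a b k<i i≤k+0 _ = contradiction (≤-trans i≤k+0 (≤-reflexive (+-identityʳ k))) (<⇒≱ k<i)
  ways-forced (suc m) k a b k<i i≤k+m eq with m≤n⇒m<n∨m≡n k<i
  ... | inj₂ refl = begin
    unless (suc k ≟ suc k) _ + unless (suc k <? suc k) (minStep (ways m (suc k)) a b)
      ≡⟨ cong₂ _+_ (unless-yes (suc k ≟ suc k) _ refl) (unless-no (suc k <? suc k) _ (<-irrefl refl)) ⟩
    minStep (ways m (suc k)) a b
      ≡⟨ minStep-cong a b (λ x y step → ways-free m (suc k) x y ≤-refl (suc-injective (trans eq (sym step)))) ⟩
    minStep ballot a b
      ≡⟨ cong (λ r → ballotAt r a b) (n∸n≡0 (suc k)) ⟨
    ballotAt (suc k ∸ suc k) a b ∎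
    where open ≡-Reasoning
  ... | inj₁ sk<i = begin
    unless (suc k ≟ i) (maxSteps (ways m (suc k)) a b) + unless (suc k <? i) _
      ≡⟨ cong₂ _+_ (unless-no (suc k ≟ i) _ (<⇒≢ sk<i)) (unless-yes (suc k <? i) _ sk<i) ⟩
    maxSteps (ways m (suc k)) a b + 0
      ≡⟨ +-identityʳ _ ⟩
    maxSteps (ways m (suc k)) a b
      ≡⟨ maxSteps-cong a b forced ⟩
    maxSteps (ballotAt (i ∸ suc (suc k))) a b
      ≡⟨ ballotAt-by-first-step (i ∸ suc (suc k)) a b ⟩
    ballotAt (suc (i ∸ suc (suc k))) a b
      ≡⟨ cong (λ r → ballotAt r a b) (+-∸-assoc 1 sk<i) ⟨
    ballotAt (i ∸ suc k) a b ∎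
    where
    open ≡-Reasoning
    forced : ∀ x y → suc (x + y) ≡ a + b → ways m (suc k) x y ≡ ballotAt (i ∸ suc (suc k)) x y
    forced x y step = ways-forced m (suc k) x y sk<i (≤-trans i≤k+m (≤-reflexive (+-suc k m)))
                        (suc-injective (trans eq (sym step)))

-- Missing a value z would let punching z out of the image inject Fin (suc N) into Fin N.
injective⇒surjective : ∀ {N} (f : Fin N → Fin N) → (∀ a b → f a ≡ f b → a ≡ b) → ∀ z → ∃ λ s → f s ≡ z
injective⇒surjective {suc N} f injective z with FinP.any? (λ s → f s FinP.≟ z)
... | yes found = found
... | no  missed
  with a , b , a<b , fa≡fb ← FinP.pigeonhole (n<1+n N) (λ s → Fin.punchOut (missed ∘ (s ,_) ∘ sym))
  = contradiction
      (injective a b (FinP.punchOut-injective (missed ∘ (a ,_) ∘ sym) (missed ∘ (b ,_) ∘ sym) fa≡fb))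
      (<⇒≢ a<b ∘ cong toℕ)

module Prefixes (n i : ℕ) where

  open Transfer i
  open import Data.List.Membership.DecPropositional (FinP._≟_ {n}) using (_∈?_)

  NewMax : List (Fin n) → Fin n → Set
  NewMax pre x = All (Fin._< x) pre

  LeastUnused : List (Fin n) → Fin n → Set
  LeastUnused pre x = x ∉ pre × (∀ z → z Fin.< x → z ∈ pre)

  FillsGap : List (Fin n) → Fin n → Set
  FillsGap pre x = ¬ NewMax pre x × LeastUnused pre x

  -- The appended letter sits at position suc (length pre), counted from 1 like i.
  MaxStep MinStep Step : List (Fin n) → Fin n → Set
  MaxStep pre x = NewMax pre x × suc (length pre) ≢ i
  MinStep pre x = FillsGap pre x × ¬ (suc (length pre) < i)
  Step pre x = MaxStep pre x ⊎ MinStep pre x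

  Admissible : List (Fin n) → List (Fin n) → Set
  Admissible pre []       = ⊤
  Admissible pre (x ∷ xs) = Step pre x × Admissible (pre ++ [ x ]) xs

  newMax? : ∀ pre x → Dec (NewMax pre x)
  newMax? pre x = All.all? (Fin._<? x) pre

  fillsGap? : ∀ pre x → Dec (FillsGap pre x)
  fillsGap? pre x = ¬? (newMax? pre x) ×-dec ¬? (x ∈? pre) ×-dec FinP.all? (λ z → z Fin.<? x →-dec z ∈? pre)

  maxStep? : ∀ pre x → Dec (MaxStep pre x)
  maxStep? pre x = newMax? pre x ×-dec ¬? (suc (length pre) ≟ i)

  minStep? : ∀ pre x → Dec (MinStep pre x)
  minStep? pre x = fillsGap? pre x ×-dec ¬? (suc (length pre) <? i)

  step? : ∀ pre x → Dec (Step pre x)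
  step? pre x = maxStep? pre x ⊎-dec minStep? pre x

  admissible? : ∀ pre xs → Dec (Admissible pre xs)
  admissible? pre []       = yes tt
  admissible? pre (x ∷ xs) = step? pre x ×-dec admissible? (pre ++ [ x ]) xs

  sup : List (Fin n) → ℕ
  sup []       = 0
  sup (y ∷ ys) = suc (toℕ y) ⊔ sup ys

  Gap : List (Fin n) → Fin n → Set
  Gap pre z = toℕ z < sup pre × z ∉ pre

  gap? : ∀ pre z → Dec (Gap pre z)
  gap? pre z = (toℕ z <? sup pre) ×-dec ¬? (z ∈? pre)

  gaps : List (Fin n) → ℕ
  gaps pre = ∑[ z < n ] 𝟙 (gap? pre z)

  length-∷ʳ : ∀ pre (x : Fin n) → length (pre ++ [ x ]) ≡ suc (length pre)
  length-∷ʳ pre x = trans (length-++ pre) (+-comm (length pre) 1)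

  ∈-∷ʳ : ∀ pre (x : Fin n) → x ∈ pre ++ [ x ]
  ∈-∷ʳ pre x = ∈-++⁺ʳ pre (here refl)

  ∉-∷ʳ : ∀ {pre} {x z : Fin n} → z ∉ pre → z ≢ x → z ∉ pre ++ [ x ]
  ∉-∷ʳ {pre} z∉pre z≢x z∈ with ∈-++⁻ pre z∈
  ... | inj₁ z∈pre       = z∉pre z∈pre
  ... | inj₂ (here z≡x) = z≢x z≡x

  sup-∷ʳ : ∀ pre x → sup (pre ++ [ x ]) ≡ sup pre ⊔ suc (toℕ x)
  sup-∷ʳ []       x = ⊔-identityʳ (suc (toℕ x))
  sup-∷ʳ (y ∷ ys) x = trans (cong (suc (toℕ y) ⊔_) (sup-∷ʳ ys x)) (sym (⊔-assoc (suc (toℕ y)) (sup ys) _))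

  ∈⇒<sup : ∀ {pre y} → y ∈ pre → toℕ y < sup pre
  ∈⇒<sup {y ∷ ys} (here refl) = m≤m⊔n (suc (toℕ y)) (sup ys)
  ∈⇒<sup {y ∷ ys} (there y∈) = ≤-trans (∈⇒<sup y∈) (m≤n⊔m (suc (toℕ y)) (sup ys))

  newMax⇒sup≤ : ∀ pre x → NewMax pre x → sup pre ≤ toℕ x
  newMax⇒sup≤ []       x []           = z≤n
  newMax⇒sup≤ (y ∷ ys) x (y<x ∷ ys<x) = ⊔-lub y<x (newMax⇒sup≤ ys x ys<x)

  sup≤⇒newMax : ∀ pre x → sup pre ≤ toℕ x → NewMax pre x
  sup≤⇒newMax []       x _   = []
  sup≤⇒newMax (y ∷ ys) x sup≤ =
    ≤-trans (m≤m⊔n (suc (toℕ y)) (sup ys)) sup≤ ∷ sup≤⇒newMax ys x (≤-trans (m≤n⊔m (suc (toℕ y)) (sup ys)) sup≤)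

  sup-newMax : ∀ pre x → NewMax pre x → sup (pre ++ [ x ]) ≡ suc (toℕ x)
  sup-newMax pre x new = trans (sup-∷ʳ pre x) (m≤n⇒m⊔n≡n (m≤n⇒m≤1+n (newMax⇒sup≤ pre x new)))

  sup-¬newMax : ∀ pre x → ¬ NewMax pre x → sup (pre ++ [ x ]) ≡ sup pre
  sup-¬newMax pre x old = trans (sup-∷ʳ pre x) (m≥n⇒m⊔n≡m (≰⇒> (old ∘ sup≤⇒newMax pre x)))

  gaps-newMax : ∀ pre x → NewMax pre x → gaps (pre ++ [ x ]) ≡ gaps pre + (toℕ x ∸ sup pre)
  gaps-newMax pre x new = begin
    gaps (pre ++ [ x ])                                ≡⟨ sum-cong-≗ {n} split ⟩
    ∑[ z < n ] (𝟙 (gap? pre z) + 𝟙 (between? z))     ≡⟨ ∑-distrib-+ (𝟙 ∘ gap? pre) (𝟙 ∘ between?) ⟩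
    gaps pre + ∑[ z < n ] 𝟙 (between? z)
      ≡⟨ cong (gaps pre +_) (∑-𝟙-interval n (sup pre) (toℕ x) (<⇒≤ (FinP.toℕ<n x))) ⟩
    gaps pre + (toℕ x ∸ sup pre)                      ∎
    where
    open ≡-Reasoning
    M≤x = newMax⇒sup≤ pre x new
    Between : Fin n → Set
    Between z = sup pre ≤ toℕ z × toℕ z < toℕ x
    between? : ∀ z → Dec (Between z)
    between? z = (sup pre ≤? toℕ z) ×-dec (toℕ z <? toℕ x)
    to : ∀ {z} → Gap (pre ++ [ x ]) z → Gap pre z ⊎ Between z
    to {z} (z<sup′ , z∉) with toℕ z <? sup pre
    ... | yes z<sup = inj₁ (z<sup , z∉ ∘ ∈-++⁺ˡ)
    ... | no  z≮sup = inj₂ (≮⇒≥ z≮sup , ≤∧≢⇒< (s≤s⁻¹ (≤-trans z<sup′ (≤-reflexive (sup-newMax pre x new)))) z≢x)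
      where
      z≢x : toℕ z ≢ toℕ x
      z≢x z≡x = z∉ (subst (_∈ pre ++ [ x ]) (sym (FinP.toℕ-injective z≡x)) (∈-∷ʳ pre x))
    from : ∀ {z} → Gap pre z ⊎ Between z → Gap (pre ++ [ x ]) z
    from {z} (inj₁ (z<sup , z∉pre)) =
      ≤-trans (m≤n⇒m≤1+n (≤-trans z<sup M≤x)) (≤-reflexive (sym (sup-newMax pre x new))) ,
      ∉-∷ʳ z∉pre (λ { refl → <⇒≱ z<sup M≤x })
    from {z} (inj₂ (sup≤z , z<x)) =
      ≤-trans (m≤n⇒m≤1+n z<x) (≤-reflexive (sym (sup-newMax pre x new))) ,
      ∉-∷ʳ (λ z∈ → <⇒≱ (∈⇒<sup z∈) sup≤z) (λ { refl → <-irrefl refl z<x })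
    split : ∀ z → 𝟙 (gap? (pre ++ [ x ]) z) ≡ 𝟙 (gap? pre z) + 𝟙 (between? z)
    split z = when-⊎ (gap? (pre ++ [ x ]) z) (gap? pre z) (between? z) 1 to from
                (λ (z<sup , _) (sup≤z , _) → <⇒≱ z<sup sup≤z)

  gaps-fillsGap : ∀ pre x → FillsGap pre x → gaps pre ≡ suc (gaps (pre ++ [ x ]))
  gaps-fillsGap pre x (old , x∉pre , _) = begin
    gaps pre                                                ≡⟨ sum-cong-≗ {n} split ⟩
    ∑[ z < n ] (𝟙 (gap? (pre ++ [ x ]) z) + 𝟙 (z FinP.≟ x))
      ≡⟨ ∑-distrib-+ (𝟙 ∘ gap? (pre ++ [ x ])) (λ z → 𝟙 (z FinP.≟ x)) ⟩
    gaps (pre ++ [ x ]) + ∑[ z < n ] 𝟙 (z FinP.≟ x)        ≡⟨ cong (gaps (pre ++ [ x ]) +_) (∑-when-≟ n x 1) ⟩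
    gaps (pre ++ [ x ]) + 1                                ≡⟨ +-comm _ 1 ⟩
    suc (gaps (pre ++ [ x ]))                              ∎
    where
    open ≡-Reasoning
    same-sup = sup-¬newMax pre x old
    to : ∀ {z} → Gap pre z → Gap (pre ++ [ x ]) z ⊎ z ≡ x
    to {z} (z<sup , z∉pre) with z FinP.≟ x
    ... | yes z≡x = inj₂ z≡x
    ... | no  z≢x = inj₁ (≤-trans z<sup (≤-reflexive (sym same-sup)) , ∉-∷ʳ z∉pre z≢x)
    from : ∀ {z} → Gap (pre ++ [ x ]) z ⊎ z ≡ x → Gap pre z
    from (inj₁ (z<sup , z∉)) = ≤-trans z<sup (≤-reflexive same-sup) , z∉ ∘ ∈-++⁺ˡ
    from (inj₂ refl)         = ≰⇒> (old ∘ sup≤⇒newMax pre x) , x∉pre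
    split : ∀ z → 𝟙 (gap? pre z) ≡ 𝟙 (gap? (pre ++ [ x ]) z) + 𝟙 (z FinP.≟ x)
    split z = when-⊎ (gap? pre z) (gap? (pre ++ [ x ]) z) (z FinP.≟ x) 1 to from
                (λ { (_ , z∉) refl → z∉ (∈-∷ʳ pre x) })

  fillsGap-exists : ∀ pre → gaps pre ≢ 0 → ∃ (FillsGap pre)
  fillsGap-exists pre gaps≢0 with FinP.any? (gap? pre)
  ... | no ∄gap = contradiction (∑-zero n (λ z → when-no (gap? pre z) 1 (∄gap ∘ (z ,_)))) gaps≢0
  ... | yes (z , z<sup , z∉pre)
    with x , x∉pre , below∈ ← FinP.¬∀⟶∃¬-smallest n (_∈ pre) (_∈? pre) (λ all∈ → z∉pre (all∈ z))
    = x , old , x∉pre , below-used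
    where
    below-used : ∀ y → y Fin.< x → y ∈ pre
    below-used y y<x = subst (_∈ pre) inject-fromℕ< (below∈ (Fin.fromℕ< y<x))
      where
      inject-fromℕ< : Fin.inject (Fin.fromℕ< y<x) ≡ y
      inject-fromℕ< = FinP.toℕ-injective (trans (FinP.toℕ-inject (Fin.fromℕ< y<x)) (FinP.toℕ-fromℕ< y<x))
    old : ¬ NewMax pre x
    old new = <⇒≱ z<sup (≤-trans (newMax⇒sup≤ pre x new) (≮⇒≥ (λ z<x → z∉pre (below-used z z<x))))

  leastUnused-unique : ∀ {pre x y} → LeastUnused pre x → LeastUnused pre y → x ≡ y
  leastUnused-unique {x = x} {y} (x∉ , below-x) (y∉ , below-y) with FinP.<-cmp x y
  ... | tri< x<y _ _ = contradiction (below-y x x<y) x∉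
  ... | tri≈ _ x≡y _ = x≡y
  ... | tri> _ _ y<x = contradiction (below-x y y<x) y∉

  completions : List (Fin n) → ℕ → ℕ
  completions pre m = ∑words m (λ w → 𝟙 (admissible? pre (toList w)))

  completions-suc : ∀ pre m →
    completions pre (suc m) ≡ ∑[ x < n ] when (step? pre x) (completions (pre ++ [ x ]) m)
  completions-suc pre m = begin
    completions pre (suc m)
      ≡⟨ ∑words-suc {n} m _ ⟩
    ∑[ x < n ] ∑words m (λ w → 𝟙 (step? pre x ×-dec admissible? (pre ++ [ x ]) (toList w)))
      ≡⟨ sum-cong-≗ {n} (λ x → cong sumˡ (map-cong (λ w → when-× (step? pre x) _ 1) (allWords m))) ⟩
    ∑[ x < n ] ∑words m (λ w → when (step? pre x) (𝟙 (admissible? (pre ++ [ x ]) (toList w))))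
      ≡⟨ sum-cong-≗ {n} (λ x → sum-map-when (step? pre x) _ (allWords m)) ⟩
    ∑[ x < n ] when (step? pre x) (completions (pre ++ [ x ]) m) ∎
    where open ≡-Reasoning

  private
    cong₃ : ∀ {A B C D : Set} (f : A → B → C → D) {a a′ b b′ c c′} →
            a ≡ a′ → b ≡ b′ → c ≡ c′ → f a b c ≡ f a′ b′ c′
    cong₃ f refl refl refl = refl

  waysAfter : ℕ → List (Fin n) → ℕ
  waysAfter m pre = ways m (length pre) (gaps pre) (n ∸ sup pre)

  -- The decisions are parameters so that splitting on them leaves maxStep? and
  -- minStep?, which contain the same tests, intact.
  ∑-maxStep : ∀ m pre (k≟i : Dec (suc (length pre) ≡ i)) →
              ∑[ x < n ] when (maxStep? pre x) (waysAfter m (pre ++ [ x ]))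
                ≡ unless k≟i (maxSteps (ways m (suc (length pre))) (gaps pre) (n ∸ sup pre))
  ∑-maxStep m pre (yes k≡i) = ∑-zero n (λ x → when-no (maxStep? pre x) _ (λ (_ , k≢i) → k≢i k≡i))
  ∑-maxStep m pre (no k≢i) = begin
    ∑[ x < n ] when (maxStep? pre x) (waysAfter m (pre ++ [ x ]))
      ≡⟨ sum-cong-≗ {n} term ⟩
    ∑[ v < n ] when (M ≤? toℕ v) (next (toℕ v))
      ≡⟨ ∑-when-≤ M n next ⟩
    ∑[ t < n ∸ M ] next (M + toℕ t)
      ≡⟨ sum-cong-≗ {n ∸ M} (shift ∘ toℕ) ⟩
    maxSteps (ways m (suc k)) (gaps pre) (n ∸ M) ∎
    where
    open ≡-Reasoning
    k = length pre
    M = sup pre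
    next : ℕ → ℕ
    next v = ways m (suc k) (gaps pre + (v ∸ M)) (n ∸ suc v)
    shift : ∀ t → next (M + t) ≡ ways m (suc k) (gaps pre + t) (n ∸ M ∸ suc t)
    shift t = cong₂ (ways m (suc k)) (cong (gaps pre +_) (m+n∸m≡n M t))
                (trans (cong (n ∸_) (sym (+-suc M t))) (sym (∸-+-assoc n M (suc t))))
    term : ∀ x → when (maxStep? pre x) (waysAfter m (pre ++ [ x ])) ≡ when (M ≤? toℕ x) (next (toℕ x))
    term x with maxStep? pre x | M ≤? toℕ x
    ... | yes (new , _) | yes _   = cong₃ (ways m) (length-∷ʳ pre x) (gaps-newMax pre x new) (cong (n ∸_) (sup-newMax pre x new))
    ... | yes (new , _) | no  M≰x = contradiction (newMax⇒sup≤ pre x new) M≰x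
    ... | no  ¬max      | yes M≤x = contradiction (sup≤⇒newMax pre x M≤x , k≢i) ¬max
    ... | no  _         | no  _   = refl

  ∑-minStep : ∀ m pre (k<?i : Dec (suc (length pre) < i)) →
              ∑[ x < n ] when (minStep? pre x) (waysAfter m (pre ++ [ x ]))
                ≡ unless k<?i (minStep (ways m (suc (length pre))) (gaps pre) (n ∸ sup pre))
  ∑-minStep m pre (yes k<i) = ∑-zero n (λ x → when-no (minStep? pre x) _ (λ (_ , k≮i) → k≮i k<i))
  ∑-minStep m pre (no k≮i) = by-gaps (gaps pre) refl
    where
    k = length pre
    by-gaps : ∀ u → gaps pre ≡ u →
              ∑[ x < n ] when (minStep? pre x) (waysAfter m (pre ++ [ x ])) ≡ minStep (ways m (suc k)) u (n ∸ sup pre)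
    by-gaps zero    gaps≡0 = ∑-zero n λ x → when-no (minStep? pre x) _
      λ (fill , _) → 0≢1+n (trans (sym gaps≡0) (gaps-fillsGap pre x fill))
    by-gaps (suc u) gaps≡1+u with x₀ , fill₀ ← fillsGap-exists pre (λ gaps≡0 → 0≢1+n (trans (sym gaps≡0) gaps≡1+u)) =
      trans (sum-cong-≗ {n} term) (∑-when-≟ n x₀ _)
      where
      term : ∀ x → when (minStep? pre x) (waysAfter m (pre ++ [ x ])) ≡ when (x FinP.≟ x₀) (ways m (suc k) u (n ∸ sup pre))
      term x with minStep? pre x | x FinP.≟ x₀
      ... | yes (fill@(old , _) , _) | yes refl =
            cong₃ (ways m) (length-∷ʳ pre x) (suc-injective (trans (sym (gaps-fillsGap pre x fill)) gaps≡1+u))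
                           (cong (n ∸_) (sup-¬newMax pre x old))
      ... | yes ((_ , least) , _) | no x≢x₀ = contradiction (leastUnused-unique least (proj₂ fill₀)) x≢x₀
      ... | no  ¬min               | yes refl = contradiction (fill₀ , k≮i) ¬min
      ... | no  _                  | no  _    = refl

  completions≡waysAfter : ∀ m pre → completions pre m ≡ waysAfter m pre
  completions≡waysAfter zero    pre = refl
  completions≡waysAfter (suc m) pre = begin
    completions pre (suc m)
      ≡⟨ completions-suc pre m ⟩
    ∑[ x < n ] when (step? pre x) (completions (pre ++ [ x ]) m)
      ≡⟨ sum-cong-≗ {n} (λ x → cong (when (step? pre x)) (completions≡waysAfter m (pre ++ [ x ]))) ⟩
    ∑[ x < n ] when (step? pre x) (waysAfter m (pre ++ [ x ]))
      ≡⟨ sum-cong-≗ {n} (λ x → when-⊎ (step? pre x) (maxStep? pre x) (minStep? pre x) _ id id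
                                        (λ (new , _) ((old , _) , _) → old new)) ⟩
    ∑[ x < n ] (when (maxStep? pre x) (next x) + when (minStep? pre x) (next x))
      ≡⟨ ∑-distrib-+ (λ x → when (maxStep? pre x) (next x)) (λ x → when (minStep? pre x) (next x)) ⟩
    ∑[ x < n ] when (maxStep? pre x) (next x) + ∑[ x < n ] when (minStep? pre x) (next x)
      ≡⟨ cong₂ _+_ (∑-maxStep m pre (suc (length pre) ≟ i)) (∑-minStep m pre (suc (length pre) <? i)) ⟩
    waysAfter (suc m) pre ∎
    where
    open ≡-Reasoning
    next : Fin n → ℕ
    next x = waysAfter m (pre ++ [ x ])

  prefix : ∀ {m} → Vec (Fin n) m → Fin m → List (Fin n)
  prefix (x ∷ w) Fin.zero    = []
  prefix (x ∷ w) (Fin.suc t) = x ∷ prefix w t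

  length-prefix : ∀ {m} (w : Vec (Fin n) m) t → length (prefix w t) ≡ toℕ t
  length-prefix (x ∷ w) Fin.zero    = refl
  length-prefix (x ∷ w) (Fin.suc t) = cong suc (length-prefix w t)

  ∈-prefix⁻ : ∀ {m} (w : Vec (Fin n) m) t {z} → z ∈ prefix w t → ∃ λ s → s Fin.< t × lookup w s ≡ z
  ∈-prefix⁻ (x ∷ w) (Fin.suc t) (here refl) = Fin.zero , s≤s z≤n , refl
  ∈-prefix⁻ (x ∷ w) (Fin.suc t) (there z∈)  with s , s<t , ws≡z ← ∈-prefix⁻ w t z∈ = Fin.suc s , s≤s s<t , ws≡z

  ∈-prefix⁺ : ∀ {m} (w : Vec (Fin n) m) {s t} → s Fin.< t → lookup w s ∈ prefix w t
  ∈-prefix⁺ (x ∷ w) {Fin.zero}  {Fin.suc t} _         = here refl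
  ∈-prefix⁺ (x ∷ w) {Fin.suc s} {Fin.suc t} (s≤s s<t) = there (∈-prefix⁺ w s<t)

  admissible⇒steps : ∀ {m} pre (w : Vec (Fin n) m) → Admissible pre (toList w) →
                     ∀ t → Step (pre ++ prefix w t) (lookup w t)
  admissible⇒steps pre (x ∷ w) (step , _)   Fin.zero    = subst (λ l → Step l x) (sym (++-identityʳ pre)) step
  admissible⇒steps pre (x ∷ w) (_ , steps) (Fin.suc t) =
    subst (λ l → Step l (lookup w t)) (++-assoc pre [ x ] (prefix w t)) (admissible⇒steps (pre ++ [ x ]) w steps t)

  steps⇒admissible : ∀ {m} pre (w : Vec (Fin n) m) → (∀ t → Step (pre ++ prefix w t) (lookup w t)) →
                     Admissible pre (toList w)
  steps⇒admissible pre []      _     = tt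
  steps⇒admissible pre (x ∷ w) steps =
    subst (λ l → Step l x) (++-identityʳ pre) (steps Fin.zero) ,
    steps⇒admissible (pre ++ [ x ]) w
      (λ t → subst (λ l → Step l (lookup w t)) (sym (++-assoc pre [ x ] (prefix w t))) (steps (Fin.suc t)))

  module _ (w : Word n) where

    newMax⇒isLTRMax : ∀ t → NewMax (prefix w t) (lookup w t) → IsLTRMax w t
    newMax⇒isLTRMax t new j j<t = All.lookup new (∈-prefix⁺ w j<t)

    isLTRMax⇒newMax : ∀ t → IsLTRMax w t → NewMax (prefix w t) (lookup w t)
    isLTRMax⇒newMax t ltr = All.tabulate λ z∈ →
      let s , s<t , ws≡z = ∈-prefix⁻ w t z∈ in subst (Fin._< lookup w t) ws≡z (ltr s s<t)

    Steps : Set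
    Steps = ∀ t → Step (prefix w t) (lookup w t)

    steps⇒distinct : Steps → ∀ {s t} → s Fin.< t → lookup w s ≢ lookup w t
    steps⇒distinct steps {s} {t} s<t ws≡wt with steps t
    ... | inj₁ (new , _)           = <⇒≢ (newMax⇒isLTRMax t new s s<t) (cong toℕ ws≡wt)
    ... | inj₂ ((_ , wt∉ , _) , _) = wt∉ (subst (_∈ prefix w t) ws≡wt (∈-prefix⁺ w s<t))

    steps⇒good : 1 ≤ i → i ≤ n → Steps → Good i w
    steps⇒good 1≤i i≤n steps = injective , avoids , earlier-ltr , k₀ , suc-k₀≡i , k₀-not-ltr
      where
      injective : IsPerm w
      injective a b wa≡wb with FinP.<-cmp a b
      ... | tri< a<b _ _ = contradiction wa≡wb (steps⇒distinct steps a<b)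
      ... | tri≈ _ a≡b _ = a≡b
      ... | tri> _ _ b<a = contradiction (sym wa≡wb) (steps⇒distinct steps b<a)
      avoids : Avoids321 w
      avoids a b c a<b b<c (wb<wa , wc<wb) with steps b
      ... | inj₁ (new , _) = <⇒≯ (newMax⇒isLTRMax b new a a<b) wb<wa
      ... | inj₂ ((_ , _ , below-used) , _)
        with s , s<b , ws≡wc ← ∈-prefix⁻ w b (below-used (lookup w c) wc<wb)
        = steps⇒distinct steps (<-trans s<b b<c) ws≡wc
      earlier-ltr : ∀ k → suc (toℕ k) < i → IsLTRMax w k
      earlier-ltr k k<i with steps k
      ... | inj₁ (new , _)   = newMax⇒isLTRMax k new
      ... | inj₂ (_ , k≮i)   = contradiction (subst (λ l → suc l < i) (sym (length-prefix w k)) k<i) k≮i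
      i∸1<n : i ∸ 1 < n
      i∸1<n = ≤-trans (≤-reflexive (trans (+-comm 1 (i ∸ 1)) (m∸n+n≡m 1≤i))) i≤n
      k₀ : Fin n
      k₀ = Fin.fromℕ< i∸1<n
      suc-k₀≡i : suc (toℕ k₀) ≡ i
      suc-k₀≡i = trans (cong suc (FinP.toℕ-fromℕ< i∸1<n)) (trans (+-comm 1 (i ∸ 1)) (m∸n+n≡m 1≤i))
      k₀-not-ltr : ¬ IsLTRMax w k₀
      k₀-not-ltr ltr with steps k₀
      ... | inj₁ (_ , k₀≢i)       = k₀≢i (trans (cong suc (length-prefix w k₀)) suc-k₀≡i)
      ... | inj₂ ((old , _) , _)  = old (isLTRMax⇒newMax k₀ ltr)

    larger-earlier : IsPerm w → ∀ t → ¬ IsLTRMax w t → ∃ λ j → j Fin.< t × lookup w t Fin.< lookup w j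
    larger-earlier injective t not-ltr
      with j , ¬[j<t⇒wj<wt] ← FinP.¬∀⟶∃¬ n (λ j → j Fin.< t → lookup w j Fin.< lookup w t)
                                 (λ j → (j Fin.<? t) →-dec (lookup w j Fin.<? lookup w t)) not-ltr
      with j Fin.<? t | lookup w j Fin.<? lookup w t
    ... | no  j≮t | _        = contradiction (λ j<t → contradiction j<t j≮t) ¬[j<t⇒wj<wt]
    ... | yes _   | yes wj<wt = contradiction (λ _ → wj<wt) ¬[j<t⇒wj<wt]
    ... | yes j<t | no  wj≮wt =
      j , j<t , ≤∧≢⇒< (≮⇒≥ wj≮wt)
                      (λ wt≡wj → <⇒≢ j<t (cong toℕ (injective j t (FinP.toℕ-injective (sym wt≡wj)))))

    good⇒steps : Good i w → Steps
    good⇒steps (injective , avoids , earlier-ltr , k₀ , suc-k₀≡i , k₀-not-ltr) t with isLTRMax? w t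
    ... | yes ltr = inj₁ (isLTRMax⇒newMax t ltr , λ k≡i → k₀-not-ltr (subst (IsLTRMax w) (t≡k₀ k≡i) ltr))
      where
      t≡k₀ : suc (length (prefix w t)) ≡ i → t ≡ k₀
      t≡k₀ k≡i = FinP.toℕ-injective (suc-injective (trans (cong suc (sym (length-prefix w t))) (trans k≡i (sym suc-k₀≡i))))
    ... | no not-ltr = inj₂ ((old , wt∉ , below-used) , k≮i)
      where
      old : ¬ NewMax (prefix w t) (lookup w t)
      old = not-ltr ∘ newMax⇒isLTRMax t
      wt∉ : lookup w t ∉ prefix w t
      wt∉ wt∈ with s , s<t , ws≡wt ← ∈-prefix⁻ w t wt∈ = <⇒≢ s<t (cong toℕ (injective s t ws≡wt))
      below-used : ∀ z → z Fin.< lookup w t → z ∈ prefix w t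
      below-used z z<wt with s , refl ← injective⇒surjective (lookup w) injective z | FinP.<-cmp s t
      ... | tri< s<t _ _ = ∈-prefix⁺ w s<t
      ... | tri≈ _ refl _ = contradiction z<wt (<-irrefl refl)
      ... | tri> _ _ t<s with j , j<t , wt<wj ← larger-earlier injective t not-ltr
        = contradiction (wt<wj , z<wt) (avoids j t s j<t t<s)
      k≮i : ¬ (suc (length (prefix w t)) < i)
      k≮i k<i = not-ltr (earlier-ltr t (subst (λ l → suc l < i) (length-prefix w t) k<i))

  g≡completions : 1 ≤ i → i ≤ n → g n i ≡ completions [] n
  g≡completions 1≤i i≤n = begin
    g n i                                                   ≡⟨ g-below-top ⟩
    length (filter (good? i) (allWords n))                  ≡⟨ length-filter≡sum-𝟙 (good? i) (allWords n) ⟩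
    ∑words n (𝟙 ∘ good? i)                                  ≡⟨ cong sumˡ (map-cong same (allWords n)) ⟩
    completions [] n                                        ∎
    where
    open ≡-Reasoning
    g-below-top : g n i ≡ length (filter (good? i) (allWords n))
    g-below-top with i ≟ suc n
    ... | yes i≡1+n = contradiction (subst (_≤ n) i≡1+n i≤n) (<-irrefl refl)
    ... | no  _     = refl
    same : ∀ w → 𝟙 (good? i w) ≡ 𝟙 (admissible? [] (toList w))
    same w = when-⇔ (good? i w) (admissible? [] (toList w)) 1
               (steps⇒admissible [] w ∘ good⇒steps w) (steps⇒good w 1≤i i≤n ∘ admissible⇒steps [] w)

  g≡ballotAt : 1 ≤ i → i ≤ n → g n i ≡ ballotAt (i ∸ 1) 0 n
  g≡ballotAt 1≤i i≤n = begin
    g n i                  ≡⟨ g≡completions 1≤i i≤n ⟩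
    completions [] n       ≡⟨ completions≡waysAfter n [] ⟩
    ways n 0 (gaps []) n   ≡⟨ cong (λ a → ways n 0 a n) (∑-zero n (λ z → when-no (gap? [] z) 1 (λ ()))) ⟩
    ways n 0 0 n           ≡⟨ ways-forced n 0 0 n 1≤i i≤n refl ⟩
    ballotAt (i ∸ 1) 0 n   ∎
    where open ≡-Reasoning

g-top : ∀ n → g n (suc n) ≡ 1
g-top n with suc n ≟ suc n
... | yes _     = refl
... | no  n≢n   = contradiction refl n≢n

2n+1∸n+1≡n : ∀ n → 2 * n + 1 ∸ suc n ≡ n
2n+1∸n+1≡n n = trans (cong (_∸ suc n) (2n+1≡n+[n+1] n)) (m+n∸n≡m n (suc n))
  where
  2n+1≡n+[n+1] : ∀ n → 2 * n + 1 ≡ n + suc n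
  2n+1≡n+[n+1] = solve-∀

formula-below-top : ∀ r e → let n = r + suc e in
  g n (suc r) * (2 * n + 1 ∸ suc r) ≡ ((2 * n + 1 ∸ suc r) C n) * r
formula-below-top r e = begin
  g n (suc r) * (2 * n + 1 ∸ suc r)   ≡⟨ cong₂ _*_ (Prefixes.g≡ballotAt n (suc r) (s≤s z≤n) (m<m+n r (s≤s z≤n))) width ⟩
  ballotAt r 0 n * (suc e * 2 + r)     ≡⟨ ballotAt-product r e ⟩
  ((suc e * 2 + r) C n) * r            ≡⟨ cong (λ m → (m C n) * r) width ⟨
  ((2 * n + 1 ∸ suc r) C n) * r        ∎
  where
  open ≡-Reasoning
  n = r + suc e
  split : ∀ r e → 2 * (r + suc e) + 1 ≡ (suc e * 2 + r) + suc r
  split = solve-∀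
  width : 2 * n + 1 ∸ suc r ≡ suc e * 2 + r
  width = trans (cong (_∸ suc r) (split r e)) (m+n∸n≡m (suc e * 2 + r) (suc r))

corollary4p13 : (n i : ℕ) → 1 ≤ n → 2 ≤ i → i ≤ suc n →
    g n i * (2 * n + 1 ∸ i) ≡ ((2 * n + 1 ∸ i) C n) * (i ∸ 1)
corollary4p13 n (suc r) _ _ i≤1+n with m≤n⇒m<n∨m≡n i≤1+n
... | inj₂ refl = begin
  g n (suc n) * (2 * n + 1 ∸ suc n)        ≡⟨ cong₂ _*_ (g-top n) (2n+1∸n+1≡n n) ⟩
  1 * n                                    ≡⟨ cong (_* n) (nCn≡1 n) ⟨
  (n C n) * n                              ≡⟨ cong (λ m → (m C n) * n) (2n+1∸n+1≡n n) ⟨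
  ((2 * n + 1 ∸ suc n) C n) * n            ∎
  where open ≡-Reasoning
... | inj₁ (s≤s i≤n) =
  subst (λ m → g m (suc r) * (2 * m + 1 ∸ suc r) ≡ ((2 * m + 1 ∸ suc r) C m) * r) n≡r+suc-e
    (formula-below-top r (n ∸ suc r))
  where
  n≡r+suc-e : r + suc (n ∸ suc r) ≡ n
  n≡r+suc-e = trans (+-suc r (n ∸ suc r)) (m+[n∸m]≡n i≤n)
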